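{- Let $G=(V,E)$ be a directed graph. If $K_n\not\subset\widetilde G$ for some integer $n\ge 2$, then $G\in\mathfrak{In}_2\text{ - }\mathfrak{Out}_2$. Moreover, if $n=2$ (i.e. $\widetilde G$ has no edges), then $G\in\mathfrak{Out}_2\cup(\mathfrak{In}_1\text{ - }\mathfrak{Out}_1)$; and if $n=3$ (i.e. $\widetilde G$ is triangle-free), then $G\in\mathfrak{In}_1\text{ - }\mathfrak{Out}_2$ or $G\in\mathfrak{In}_2\text{ - }\mathfrak{Out}_1$.
   Context: Digraphs $G=(V,E)$, $E\subseteq V\times V$, may be infinite. The undirected complement of $G$ is the undirected graph $\widetilde G=(V,\widetilde E)$ where, for distinct $x,y\in V$, $\{x,y\}\in\widetilde E$ iff $(x,y)\notin E$ and $(y,x)\notin E$. $K_n$ is the complete graph on $n$ vertices, and $K_n\not\subset\widetilde G$ means $\widetilde G$ has no subgraph isomorphic to $K_n$. For $W\subseteq V$, $G[W]=(W,E\cap (W\times W))$ is the induced subgraph. A set $A\subseteq V$ is independent if there is no edge (in either direction) of $G$ between two distinct elements of $A$. For $n\in\mathbb N$ and $A\subseteq V$, $\mathrm{Out}^G_n(A)$ (resp. $\mathrm{In}^G_n(A)$) is the set of all $v\in V$ such that there is a directed path of length at most $n$ from some point of $A$ to $v$ (resp. from $v$ to some point of $A$); length $0$ is allowed. $G\in\mathfrak{Out}_n$ (resp. $G\in\mathfrak{In}_n$) iff there is an independent $A\subseteq V$ with $V=\mathrm{Out}^G_n(A)$ (resp. $V=\mathrm{In}^G_n(A)$). $G\in\mathfrak{In}_n\text{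 - }\mathfrak{Out}_k$ iff there is a partition $(V_1,V_2)$ of $V$ (parts may be empty) with $G[V_1]\in\mathfrak{In}_n$ and $G[V_2]\in\mathfrak{Out}_k$. -}

module Defs where

open import Axiom.ExcludedMiddle using (ExcludedMiddle)
open import Data.Fin.Base using (Fin)
open import Data.List.Base using (List; []; _∷_)
open import Data.List.Relation.Unary.Unique.Propositional using (Unique)
open import Data.Nat.Base using (ℕ; zero; suc; _≤_)
open import Data.Product.Base using (Σ-syntax; ∃-syntax; _×_; _,_)
open import Data.Refinement using (Refinement; value)
open import Function.Definitions using (Injective)
open import Level using (Level; Setω; 0ℓ; _⊔_) renaming (suc to lsuc)
open import Relation.Binary.Core using (Rel)
open import Relation.Binary.Definitions using (Symmetric; Irreflexive)
open import Relation.Binary.PropositionalEquality.Core using (_≡_; _≢_; refl; ≢-sym)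
open import Relation.Nullary.Negation.Core using (¬_)
open import Relation.Unary using (Pred; _∈_; Universal; Empty; _∪_; _∩_)

-- Excluded middle in every universe. Since Dec P returns an element of P,
-- and Σ-types already satisfy the axiom of choice, this assumption
-- provides the full classical background, including choice.
Classical : Setω
Classical = ∀ {ℓ} → ExcludedMiddle ℓ

-- Loops are allowed; only the inhabitation of Edge x y is meaningful.
record Digraph (v e : Level) : Set (lsuc (v ⊔ e)) where
  field
    Vertex : Set v
    Edge   : Rel Vertex e

record UndirectedGraph (v e : Level) : Set (lsuc (v ⊔ e)) where
  field
    Vertex : Set v
    Adj    : Rel Vertex e
    sym    : Symmetric Adj
    irrefl : Irreflexive _≡_ Adj

K : ℕ → UndirectedGraph 0ℓ 0ℓ
K n = record
  { Vertex = Fin n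
  ; Adj    = _≢_
  ; sym    = ≢-sym
  ; irrefl = λ x≡y x≢y → x≢y x≡y
  }

-- H ⊂ᴳ Γ: some subgraph of Γ, not necessarily induced, is isomorphic to H.
-- The subgraph is given by its parametrisation by H, i.e. by an injective
-- map on vertices that preserves adjacency.
infix 4 _⊂ᴳ_
_⊂ᴳ_ : ∀ {v e v′ e′} → UndirectedGraph v e → UndirectedGraph v′ e′ →
       Set (v ⊔ e ⊔ v′ ⊔ e′)
H ⊂ᴳ Γ =
  Σ[ f ∈ (UndirectedGraph.Vertex H → UndirectedGraph.Vertex Γ) ]
    Injective _≡_ _≡_ f ×
    (∀ x y → UndirectedGraph.Adj H x y → UndirectedGraph.Adj Γ (f x) (f y))

module _ {v e : Level} (G : Digraph v e) where
  open Digraph G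

  complement : UndirectedGraph v (v ⊔ e)
  complement = record
    { Vertex = Vertex
    ; Adj    = λ x y → x ≢ y × ¬ Edge x y × ¬ Edge y x
    ; sym    = λ { (x≢y , ¬xy , ¬yx) → ≢-sym x≢y , ¬yx , ¬xy }
    ; irrefl = λ { x≡y (x≢y , _) → x≢y x≡y }
    }

  -- Refinement keeps the membership proof irrelevant, so that each vertex
  -- in W gives exactly one vertex of the induced subgraph.
  induced : ∀ {w} → Pred Vertex w → Digraph (v ⊔ w) e
  induced W = record
    { Vertex = Refinement Vertex W
    ; Edge   = λ x y → Edge (value x) (value y)
    }

  Independent : ∀ {a} → Pred Vertex a → Set (v ⊔ e ⊔ a)
  Independent A = ∀ x y → x ∈ A → y ∈ A → x ≢ y → ¬ Edge x y

  data Walk : ℕ → Vertex → Vertex → Set (v ⊔ e) where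
    stop : ∀ {x} → Walk zero x x
    step : ∀ {m x y z} → Edge x y → Walk m y z → Walk (suc m) x z

  vertices : ∀ {m x y} → Walk m x y → List Vertex
  vertices (stop {x})         = x ∷ []
  vertices (step {x = x} _ w) = x ∷ vertices w

  Path : ℕ → Vertex → Vertex → Set (v ⊔ e)
  Path m x y = Σ[ w ∈ Walk m x y ] Unique (vertices w)

  Out : ∀ {a} → ℕ → Pred Vertex a → Pred Vertex (v ⊔ e ⊔ a)
  Out n A y = ∃[ x ] x ∈ A × (∃[ m ] m ≤ n × Path m x y)

  In : ∀ {a} → ℕ → Pred Vertex a → Pred Vertex (v ⊔ e ⊔ a)
  In n A x = ∃[ y ] y ∈ A × (∃[ m ] m ≤ n × Path m x y)

-- The universe level v ⊔ e of the subsets below is a convenience: under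
-- Classical, every predicate is equivalent to one in any other universe.

𝔒𝔲𝔱 : ∀ {v e} → ℕ → Digraph v e → Set (lsuc (v ⊔ e))
𝔒𝔲𝔱 {v} {e} n G =
  Σ[ A ∈ Pred (Digraph.Vertex G) (v ⊔ e) ]
    Independent G A × Universal (Out G n A)

ℑ𝔫 : ∀ {v e} → ℕ → Digraph v e → Set (lsuc (v ⊔ e))
ℑ𝔫 {v} {e} n G =
  Σ[ A ∈ Pred (Digraph.Vertex G) (v ⊔ e) ]
    Independent G A × Universal (In G n A)

ℑ𝔫-𝔒𝔲𝔱 : ∀ {v e} → ℕ → ℕ → Digraph v e → Set (lsuc (v ⊔ e))
ℑ𝔫-𝔒𝔲𝔱 {v} {e} n k G =
  Σ[ V₁ ∈ Pred (Digraph.Vertex G) (v ⊔ e) ]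
  Σ[ V₂ ∈ Pred (Digraph.Vertex G) (v ⊔ e) ]
    Universal (V₁ ∪ V₂) × Empty (V₁ ∩ V₂) ×
    ℑ𝔫 n (induced G V₁) × 𝔒𝔲𝔱 k (induced G V₂)

{-# OPTIONS --safe #-}

-- The proof is an induction on n over the subsets W of V. Let M be a maximal independent subset
-- of W. If M reaches W in two steps, M is a quasi-kernel of W. Otherwise fix r ∈ W out of its
-- reach and let T be the set of the successors of M that do not lie in In₁(M), so that
-- W = In₁(M) ∪ T. No vertex of T has an edge to r, hence T splits into successors of r and the
-- set U of vertices not adjacent to r. As r extends every independent subset of U, the set U
-- falls under the case n - 1; let U = U₁ ∪ U₂ with a sink A₁ of U₁ and a kernel A₂ of U₂.
-- Then {r} ∪ A₂ is a kernel of {r} ∪ (T ∩ Out(r)) ∪ U₂. In the rest of W, the set A₁ together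
-- with the points of M without an edge to A₁ is independent, since T has no edges to M, and
-- every vertex of In₁(M) reaches it in two steps; if U₁ is empty, M itself is reached in one.
-- For n = 2 the set U is empty; for n = 3 it is the case n = 2 that applies to U.
module Submission where

open import Defs
open import Data.Empty using (⊥; ⊥-elim)
open import Data.Fin.Base using (Fin; zero; suc)
import Data.Fin.Properties as Fin
open import Data.Irrelevant using ([_])
open import Data.List.Membership.Propositional using () renaming (_∈_ to _∈ˡ_)
import Data.List.Relation.Unary.All as All
open import Data.List.Relation.Unary.All.Properties using (¬Any⇒All¬)
open import Data.List.Relation.Unary.Any using (here; there)
open import Data.List.Relation.Unary.Unique.Propositional using (Unique; []; _∷_)
open import Data.Nat.Base using (ℕ; zero; suc; _≤_; z≤n; s≤s)
open import Data.Nat.Properties using (≤-refl; ≤-trans; m≤n⇒m≤1+n)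
open import Data.Product.Base using (Σ-syntax; ∃-syntax; _×_; _,_; proj₁; proj₂)
open import Data.Refinement using (Refinement; _,_; value; value-injective)
open import Data.Sum.Base using (_⊎_; inj₁; inj₂; [_,_]′) renaming (map to ⊎-map)
open import Data.Unit.Polymorphic.Base using (⊤; tt)
open import Data.Vec.Functional using () renaming (_∷_ to _∷ᶠ_)
open import Function.Base using (flip; _∘_; _on_; id)
open import Level using (Level; Lift; lift; lower; 0ℓ; _⊔_) renaming (suc to lsuc)
open import Relation.Binary.Core using (Rel)
open import Relation.Binary.PropositionalEquality.Core using (_≡_; _≢_; refl; cong; ≢-sym)
open import Relation.Nullary.Decidable using (yes; no; recompute; decidable-stable)
open import Relation.Nullary.Negation.Core using (¬_; contradiction)
open import Relation.Unary using (Pred; _∈_; _⊆_; _∩_; _∪_; Empty; Universal)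

private variable
  a b w w′ : Level

-- Kernels and sinks of subsets

module _ {v e} {V : Set v} (R : Rel V e) where

  -- The walks stay in W, except that x itself is not required to be in W.
  Reach : Pred V w → ℕ → Pred V a → Pred V (v ⊔ e ⊔ w ⊔ a)
  Reach {w} W zero    A x = Lift (v ⊔ e ⊔ w) (A x)
  Reach     W (suc k) A x = Reach W k A x ⊎ (∃[ y ] Reach W k A y × W y × R y x)

  NoEdges : Pred V a → Set (v ⊔ e ⊔ a)
  NoEdges A = ∀ x y → x ∈ A → y ∈ A → x ≢ y → ¬ R x y

  -- Subsets of one fixed `V` stand for induced subgraphs, so that the induction needs no nested
  -- refinements. A sink is a kernel for `flip R`.
  record Kernel (k : ℕ) (W : Pred V (v ⊔ e)) : Set (lsuc (v ⊔ e)) where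
    constructor kernel
    field
      set    : Pred V (v ⊔ e)
      inside : set ⊆ W
      indep  : NoEdges set
      covers : W ⊆ Reach W k set

  module _ {W : Pred V w} where

    reach-self : ∀ k {A : Pred V a} → A ⊆ Reach W k A
    reach-self zero    Ax = lift Ax
    reach-self (suc k) Ax = inj₁ (reach-self k Ax)

    reach-edge : ∀ k {A : Pred V a} {x y} → y ∈ A → y ∈ W → R y x → Reach W (suc k) A x
    reach-edge k Ay Wy Ryx = inj₂ (_ , reach-self k Ay , Wy , Ryx)

    reach-≤ : ∀ {j k} {A : Pred V a} → j ≤ k → Reach W j A ⊆ Reach W k A
    reach-≤ {k = k} z≤n (lift Ax)              = reach-self k Ax
    reach-≤ (s≤s j≤k) (inj₁ p)                  = inj₁ (reach-≤ j≤k p)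
    reach-≤ (s≤s j≤k) (inj₂ (y , p , Wy , Ryx)) = inj₂ (y , reach-≤ j≤k p , Wy , Ryx)

  reach-⊆ : ∀ {W : Pred V w} {W′ : Pred V w′} k {A : Pred V a} {B : Pred V b} →
            W ⊆ W′ → A ⊆ B → Reach W k A ⊆ Reach W′ k B
  reach-⊆ zero    W⊆ A⊆ (lift Ax)               = lift (A⊆ Ax)
  reach-⊆ (suc k) W⊆ A⊆ (inj₁ p)                = inj₁ (reach-⊆ k W⊆ A⊆ p)
  reach-⊆ (suc k) W⊆ A⊆ (inj₂ (y , p , Wy , Ryx)) =
    inj₂ (y , reach-⊆ k W⊆ A⊆ p , W⊆ Wy , Ryx)

  empty-kernel : ∀ k {W} → Empty W → Kernel k W
  empty-kernel k W-empty = record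
    { set    = λ _ → Lift _ ⊥
    ; inside = λ ()
    ; indep  = λ _ _ ()
    ; covers = λ Wx → ⊥-elim (W-empty _ Wx)
    }

record Split {v e} {V : Set v} (R : Rel V e) (i k : ℕ) (W : Pred V (v ⊔ e)) :
             Set (lsuc (v ⊔ e)) where
  field
    V₁ V₂    : Pred V (v ⊔ e)
    V₁⊆W     : V₁ ⊆ W
    V₂⊆W     : V₂ ⊆ W
    exhaust  : W ⊆ V₁ ∪ V₂
    disjoint : Empty (V₁ ∩ V₂)
    sink     : Kernel (flip R) i V₁
    source   : Kernel R k V₂

module _ {v e} {V : Set v} {R : Rel V e} where

  kernel⇒split : ∀ i {k W} → Kernel R k W → Split R i k W
  kernel⇒split i {W = W} K = record
    { V₁       = λ _ → Lift _ ⊥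
    ; V₂       = W
    ; V₁⊆W     = λ ()
    ; V₂⊆W     = id
    ; exhaust  = inj₂
    ; disjoint = λ _ ()
    ; sink     = empty-kernel (flip R) i (λ _ ())
    ; source   = K
    }

-- The inductive step

module _ {v e} {V : Set v} (R : Rel V e) where

  NonAdj : Rel V (v ⊔ e)
  NonAdj x y = x ≢ y × ¬ R x y × ¬ R y x

  -- A copy of `K n` in the complement with all vertices in `W`; `NonAdj` includes inequality, so
  -- `f` is injective.
  IndependentTuple : ℕ → Pred V w → Set (v ⊔ e ⊔ w)
  IndependentTuple n W =
    Σ[ f ∈ (Fin n → V) ] (∀ i → f i ∈ W) × (∀ i j → i ≢ j → NonAdj (f i) (f j))

  extend : ∀ {n} {W : Pred V w} {x} → x ∈ W → ((f , _) : IndependentTuple n W) →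
           (∀ i → NonAdj x (f i)) → IndependentTuple (suc n) W
  extend {x = x} Wx (f , f∈W , f-indep) x-f =
    x ∷ᶠ f ,
    (λ { zero → Wx ; (suc i) → f∈W i }) ,
    λ { zero    zero    i≢j → contradiction refl i≢j
      ; zero    (suc j) _   → x-f j
      ; (suc i) zero    _   → let (x≢ , xf , fx) = x-f i in ≢-sym x≢ , fx , xf
      ; (suc i) (suc j) i≢j → f-indep i j (i≢j ∘ cong suc)
      }

  -- The field `maximal` is maximality in positive form: a vertex of `W` outside both one-step
  -- neighbourhoods could be added to `M`.
  record MaximalIndependent (W : Pred V (v ⊔ e)) : Set (lsuc (v ⊔ e)) where
    field
      M       : Pred V (v ⊔ e)
      M⊆W     : M ⊆ W
      indep   : NoEdges R M
      maximal : W ⊆ Reach (flip R) W 1 M ∪ Reach R W 1 M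

module _ (em : Classical) {v e} {V : Set v} (R : Rel V e) where

  -- Greedy extension: a tuple that cannot be prolonged within `W` has a maximal independent range.
  -- A bound on the length of tuples therefore yields such a set even in an infinite `W`.
  tuple⊎maximal : ∀ k (W : Pred V (v ⊔ e)) → IndependentTuple R k W ⊎ MaximalIndependent R W
  tuple⊎maximal zero    W = inj₁ ((λ ()) , (λ ()) , λ ())
  tuple⊎maximal (suc k) W with tuple⊎maximal k W
  ... | inj₂ m = inj₂ m
  ... | inj₁ t@(f , f∈W , f-indep) with em {P = ∃[ x ] x ∈ W × (∀ i → NonAdj R x (f i))}
  ...   | yes (x , Wx , x-f) = inj₁ (extend R Wx t x-f)
  ...   | no stuck = inj₂ record
    { M       = M
    ; M⊆W     = λ { (lift (i , refl)) → f∈W i }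
    ; indep   = λ { _ _ (lift (i , refl)) (lift (j , refl)) fi≢fj →
                    proj₁ (proj₂ (f-indep i j (fi≢fj ∘ cong f))) }
    ; maximal = maximal
    }
    where
    M : Pred V (v ⊔ e)
    M x = Lift e (∃[ i ] x ≡ f i)

    maximal : W ⊆ Reach (flip R) W 1 M ∪ Reach R W 1 M
    maximal {x} Wx with em {P = Reach (flip R) W 1 M x} | em {P = Reach R W 1 M x}
    ... | yes p | _     = inj₁ p
    ... | no _  | yes q = inj₂ q
    ... | no ¬p | no ¬q = ⊥-elim (stuck (x , Wx , λ i →
        (λ { refl → ¬p (inj₁ (lift (lift (i , refl)))) })
      , (λ Rxf → ¬p (reach-edge (flip R) 0 (lift (i , refl)) (f∈W i) Rxf))
      , (λ Rfx → ¬q (reach-edge R 0 (lift (i , refl)) (f∈W i) Rfx))))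

  -- A vertex beyond two steps from a maximal independent set.

  module Step {W : Pred V (v ⊔ e)} (MI : MaximalIndependent R W)
              {r} (Wr : r ∈ W) (r∉Out₂ : ¬ Reach R W 2 (MaximalIndependent.M MI) r) where
    open MaximalIndependent MI

    T U : Pred V (v ⊔ e)
    T x = W x × ¬ Reach (flip R) W 1 M x × Reach R W 1 M x
    U x = T x × ¬ R r x

    -- A vertex of `T` is within one step of `M`, so an edge to `r` would bring `r` within two.
    T-no-edge-to-r : ∀ {x} → x ∈ T → ¬ R x r
    T-no-edge-to-r (Wx , _ , q) Rxr = r∉Out₂ (inj₂ (_ , q , Wx , Rxr))

    r∉T : ¬ T r
    r∉T (_ , _ , q) = r∉Out₂ (inj₁ q)

    r∉M : ¬ M r
    r∉M Mr = r∉Out₂ (reach-self R 2 Mr)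

    M∩T-empty : ∀ {x} → x ∈ M → ¬ T x
    M∩T-empty Mx (_ , ¬p , _) = ¬p (reach-self (flip R) 1 Mx)

    T-no-edge-to-M : ∀ {x m} → x ∈ T → m ∈ M → ¬ R x m
    T-no-edge-to-M (_ , ¬p , _) Mm Rxm = ¬p (reach-edge (flip R) 0 Mm (M⊆W Mm) Rxm)

    U-nonadjacent-r : ∀ {x} → x ∈ U → NonAdj R r x
    U-nonadjacent-r (Tx , ¬Rrx) =
      (λ { refl → r∉T Tx }) , ¬Rrx , T-no-edge-to-r Tx

    -- This lowers the bound on independent tuples by one on passing from `W` to `U`, which drives
    -- the induction.
    extend-by-r : ∀ {n} → IndependentTuple R n U → IndependentTuple R (suc n) W
    extend-by-r (f , f∈U , f-indep) =
      extend R Wr (f , (λ i → proj₁ (proj₁ (f∈U i))) , f-indep) (λ i → U-nonadjacent-r (f∈U i))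

    -- The source radius is positive because `r` needs one step to cover its successors in `T`.
    module _ {i k} (S : Split R i (suc k) U) where
      open Split S using (exhaust; disjoint) renaming (V₁ to U₁; V₂ to U₂; V₁⊆W to U₁⊆U; V₂⊆W to U₂⊆U)
      open Kernel (Split.sink S)
        using () renaming (set to A₁; inside to A₁⊆U₁; indep to A₁-indep; covers to A₁-covers)
      open Kernel (Split.source S)
        using () renaming (set to A₂; inside to A₂⊆U₂; indep to A₂-indep; covers to A₂-covers)

      W₁ W₂ : Pred V (v ⊔ e)
      W₂ x = x ≡ r ⊎ (T x × R r x) ⊎ U₂ x
      W₁ x = W x × ¬ W₂ x

      W₂⊆W : W₂ ⊆ W
      W₂⊆W (inj₁ refl)                = Wr
      W₂⊆W (inj₂ (inj₁ ((Wx , _) , _))) = Wx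
      W₂⊆W (inj₂ (inj₂ U₂x))          = proj₁ (proj₁ (U₂⊆U U₂x))

      W⊆W₁∪W₂ : W ⊆ W₁ ∪ W₂
      W⊆W₁∪W₂ {x} Wx with em {P = W₂ x}
      ... | yes p = inj₂ p
      ... | no ¬p = inj₁ (Wx , ¬p)

      M⊆W₁ : M ⊆ W₁
      M⊆W₁ Mx = M⊆W Mx ,
        [ (λ { refl → r∉M Mx })
        , [ M∩T-empty Mx ∘ proj₁ , M∩T-empty Mx ∘ proj₁ ∘ U₂⊆U ]′ ]′

      U₁⊆W₁ : U₁ ⊆ W₁
      U₁⊆W₁ U₁x with (Tx , ¬Rrx) ← U₁⊆U U₁x = proj₁ Tx ,
        [ (λ { refl → r∉T Tx })
        , [ ¬Rrx ∘ proj₂ , (λ U₂x → disjoint _ (U₁x , U₂x)) ]′ ]′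

      -- A step into `M` stays in `W₁` since `M` does. A vertex without one lies in `T` by
      -- maximality; being outside `W₂`, it is no successor of `r`, hence is in `U` but not in `U₂`.
      W₁⊆In₁M∪U₁ : W₁ ⊆ Reach (flip R) W₁ 1 M ∪ U₁
      W₁⊆In₁M∪U₁ {x} (Wx , ¬W₂x) with em {P = Reach (flip R) W 1 M x}
      ... | yes (inj₁ Mx)               = inj₁ (inj₁ (lift (lower Mx)))
      ... | yes (inj₂ (_ , lift Mm , _ , Rxm)) = inj₁ (reach-edge (flip R) 0 Mm (M⊆W₁ Mm) Rxm)
      ... | no ¬p with maximal Wx
      ...   | inj₁ p = contradiction p ¬p
      ...   | inj₂ q with exhaust ((Wx , ¬p , q) , λ Rrx → ¬W₂x (inj₂ (inj₁ ((Wx , ¬p , q) , Rrx))))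
      ...     | inj₁ U₁x = inj₂ U₁x
      ...     | inj₂ U₂x = ⊥-elim (¬W₂x (inj₂ (inj₂ U₂x)))

      source-kernel : Kernel R (suc k) W₂
      source-kernel = record { set = B ; inside = inside ; indep = indep′ ; covers = covers }
        where
        B : Pred V (v ⊔ e)
        B x = x ≡ r ⊎ A₂ x

        inside : B ⊆ W₂
        inside = ⊎-map id (inj₂ ∘ A₂⊆U₂)

        indep′ : NoEdges R B
        indep′ x y (inj₁ refl) (inj₁ refl) x≢y = contradiction refl x≢y
        indep′ x y (inj₁ refl) (inj₂ A₂y)  _   = proj₂ (U₂⊆U (A₂⊆U₂ A₂y))
        indep′ x y (inj₂ A₂x)  (inj₁ refl) _   = T-no-edge-to-r (proj₁ (U₂⊆U (A₂⊆U₂ A₂x)))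
        indep′ x y (inj₂ A₂x)  (inj₂ A₂y)      = A₂-indep x y A₂x A₂y

        covers : W₂ ⊆ Reach R W₂ (suc k) B
        covers (inj₁ refl)             = reach-self R (suc k) (inj₁ refl)
        covers (inj₂ (inj₁ (_ , Rrx))) = reach-edge R k (inj₁ refl) (inj₁ refl) Rrx
        covers (inj₂ (inj₂ U₂x))       = reach-⊆ R (suc k) (inj₂ ∘ inj₂) inj₂ (A₂-covers U₂x)

      with-sink : ∀ {j} → Kernel (flip R) j W₁ → Split R j (suc k) W
      with-sink K = record
        { V₁       = W₁
        ; V₂       = W₂
        ; V₁⊆W     = proj₁
        ; V₂⊆W     = W₂⊆W
        ; exhaust  = W⊆W₁∪W₂
        ; disjoint = λ { _ ((_ , ¬W₂x) , W₂x) → ¬W₂x W₂x }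
        ; sink     = K
        ; source   = source-kernel
        }

      sink₁ : Empty U₁ → Kernel (flip R) 1 W₁
      sink₁ U₁-empty = record
        { set    = M
        ; inside = M⊆W₁
        ; indep  = λ x y Mx My x≢y → indep y x My Mx (≢-sym x≢y)
        ; covers = λ W₁x → [ id , (λ U₁x → ⊥-elim (U₁-empty _ U₁x)) ]′ (W₁⊆In₁M∪U₁ W₁x)
        }

      sink₂ : i ≤ 2 → Kernel (flip R) 2 W₁
      sink₂ i≤2 = record { set = B ; inside = inside ; indep = indep′ ; covers = covers }
        where
        B : Pred V (v ⊔ e)
        B x = (M x × ¬ (∃[ a ] a ∈ A₁ × R x a)) ⊎ A₁ x

        inside : B ⊆ W₁
        inside = [ M⊆W₁ ∘ proj₁ , U₁⊆W₁ ∘ A₁⊆U₁ ]′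

        A₁⊆T : A₁ ⊆ T
        A₁⊆T = proj₁ ∘ U₁⊆U ∘ A₁⊆U₁

        indep′ : NoEdges (flip R) B
        indep′ x y (inj₁ (Mx , _)) (inj₁ (My , _)) x≢y = indep y x My Mx (≢-sym x≢y)
        indep′ x y (inj₁ (Mx , _)) (inj₂ A₁y)      _   = T-no-edge-to-M (A₁⊆T A₁y) Mx
        indep′ x y (inj₂ A₁x)      (inj₁ (_ , ¬a)) _   = λ Ryx → ¬a (x , A₁x , Ryx)
        indep′ x y (inj₂ A₁x)      (inj₂ A₁y)          = A₁-indep x y A₁x A₁y

        -- The points of `M` left out of `B` are exactly those with an edge to `A₁`, so they are one
        -- step from `B`. This puts In₁(M) within two steps.
        M-covered : M ⊆ Reach (flip R) W₁ 1 B
        M-covered {x} Mx with em {P = ∃[ a ] a ∈ A₁ × R x a}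
        ... | yes (a , A₁a , Rxa) = reach-edge (flip R) 0 (inj₂ A₁a) (inside (inj₂ A₁a)) Rxa
        ... | no ¬a               = reach-self (flip R) 1 (inj₁ (Mx , ¬a))

        covers : W₁ ⊆ Reach (flip R) W₁ 2 B
        covers W₁x with W₁⊆In₁M∪U₁ W₁x
        ... | inj₁ (inj₁ (lift Mx))                  = inj₁ (M-covered Mx)
        ... | inj₁ (inj₂ (m , lift Mm , W₁m , Rxm)) = inj₂ (m , M-covered Mm , W₁m , Rxm)
        -- Here the walk runs inside `U₁` and has at most `i` steps, whence the bound on `i`.
        ... | inj₂ U₁x =
          reach-≤ (flip R) i≤2 (reach-⊆ (flip R) i U₁⊆W₁ inj₂ (A₁-covers U₁x))

    split-from-kernel : ∀ {k} → Kernel R (suc k) U → Split R 1 (suc k) W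
    split-from-kernel K = with-sink S (sink₁ S (λ _ ()))
      -- The sink part of this split is empty, so the radius `0` is an arbitrary choice.
      where S = kernel⇒split 0 K

    split-from-split : ∀ {i k} → i ≤ 2 → Split R i (suc k) U → Split R 2 (suc k) W
    split-from-split i≤2 S = with-sink S (sink₂ S i≤2)

  -- The alternative shared by the three results below. The maximal independent set and `r` are
  -- carried along because `U` depends on them.
  data Cases (n : ℕ) (W : Pred V (v ⊔ e)) : Set (lsuc (v ⊔ e)) where
    quasi-kernel : Kernel R 2 W → Cases n W
    unreached    : (MI : MaximalIndependent R W) → ∀ {r} (Wr : r ∈ W)
                   (r∉Out₂ : ¬ Reach R W 2 (MaximalIndependent.M MI) r) →
                   ¬ IndependentTuple R n (Step.U MI Wr r∉Out₂) → Cases n W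

  cases : ∀ n W → ¬ IndependentTuple R (suc n) W → Cases n W
  cases n W ¬t with tuple⊎maximal (suc n) W
  ... | inj₁ t  = contradiction t ¬t
  ... | inj₂ MI with em {P = ∃[ r ] r ∈ W × ¬ Reach R W 2 (MaximalIndependent.M MI) r}
  ...   | yes (r , Wr , r∉) = unreached MI Wr r∉ (¬t ∘ Step.extend-by-r MI Wr r∉)
  ...   | no ¬r = quasi-kernel (kernel M M⊆W indep covers)
    where
    open MaximalIndependent MI
    covers : W ⊆ Reach R W 2 M
    covers {x} Wx with em {P = Reach R W 2 M x}
    ... | yes p = p
    ... | no ¬p = ⊥-elim (¬r (x , Wx , ¬p))

  split₂₂ : ∀ n W → ¬ IndependentTuple R n W → Split R 2 2 W
  -- Every `W` contains the empty tuple, so the hypothesis fails here.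
  split₂₂ zero    W ¬t = contradiction ((λ ()) , (λ ()) , λ ()) ¬t
  split₂₂ (suc n) W ¬t with cases n W ¬t
  ... | quasi-kernel K          = kernel⇒split 2 K
  ... | unreached MI Wr r∉ ¬tU = Step.split-from-split MI Wr r∉ ≤-refl (split₂₂ n _ ¬tU)

  kernel₂⊎split₁₁ : ∀ W → ¬ IndependentTuple R 2 W → Kernel R 2 W ⊎ Split R 1 1 W
  kernel₂⊎split₁₁ W ¬t with cases 1 W ¬t
  ... | quasi-kernel K         = inj₁ K
  ... | unreached MI Wr r∉ ¬tU = inj₂ (Step.split-from-kernel MI Wr r∉ (empty-kernel R 1 U-empty))
    where
    U-empty : Empty (Step.U MI Wr r∉)
    -- A single vertex is an independent 1-tuple, as no two indices are distinct.
    U-empty x Ux = ¬tU ((λ _ → x) , (λ _ → Ux) , λ { zero zero i≢j → contradiction refl i≢j })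

  split₁₂⊎split₂₁ : ∀ W → ¬ IndependentTuple R 3 W → Split R 1 2 W ⊎ Split R 2 1 W
  split₁₂⊎split₂₁ W ¬t with cases 2 W ¬t
  ... | quasi-kernel K = inj₁ (kernel⇒split 1 K)
  ... | unreached MI Wr r∉ ¬tU =
    -- A kernel of `U` keeps source radius 2 and leaves `M` as a sink of radius 1; a split of `U`
    -- with radii 1 and 1 keeps source radius 1 and gives sink radius 2.
    ⊎-map (Step.split-from-kernel MI Wr r∉) (Step.split-from-split MI Wr r∉ (s≤s z≤n))
          (kernel₂⊎split₁₁ _ ¬tU)

-- From subsets of V to induced subgraphs

module _ (em : Classical) {v e} (H : Digraph v e) where
  open Digraph H

  suffix : ∀ {m x y z} (p : Walk H m x y) → Unique (vertices H p) → z ∈ˡ vertices H p →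
           ∃[ m′ ] m′ ≤ m × Path H m′ z y
  suffix stop         u       (here refl) = _ , ≤-refl , stop , u
  suffix p@(step _ _) u       (here refl) = _ , ≤-refl , p , u
  suffix (step _ p)   (_ ∷ u) (there z∈p) =
    let (m′ , m′≤m , q) = suffix p u z∈p in m′ , m≤n⇒m≤1+n m′≤m , q

  -- If `x` recurs on the path already found, the loop is cut off by `suffix`; excluded middle
  -- decides whether it recurs.
  walk⇒path : ∀ {m x y} → Walk H m x y → ∃[ m′ ] m′ ≤ m × Path H m′ x y
  walk⇒path stop = 0 , z≤n , stop , All.[] ∷ []
  walk⇒path {x = x} (step xy w) with walk⇒path w
  ... | m′ , m′≤m , p , u with em {P = x ∈ˡ vertices H p}
  ...   | yes x∈p = let (m″ , m″≤m′ , q) = suffix p u x∈p in m″ , m≤n⇒m≤1+n (≤-trans m″≤m′ m′≤m) , q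
  ...   | no  x∉p = suc m′ , s≤s m′≤m , step xy p , ¬Any⇒All¬ _ x∉p ∷ u

  -- `Reach` adds edges at the end away from `A`, which for outgoing walks is the end opposite to
  -- that of `step`.
  snoc : ∀ {m x y z} → Walk H m x y → Edge y z → Walk H (suc m) x z
  snoc stop        yz = step yz stop
  snoc (step xw w) yz = step xw (snoc w yz)

  module _ {W : Pred Vertex w} {A : Pred Vertex a} where

    reach⇒walk-out : ∀ k {y} → Reach Edge W k A y → ∃[ x ] x ∈ A × (∃[ m ] m ≤ k × Walk H m x y)
    reach⇒walk-out zero    (lift Ay) = _ , Ay , 0 , z≤n , stop
    reach⇒walk-out (suc k) (inj₁ p)  =
      let (x , Ax , m , m≤k , w) = reach⇒walk-out k p in x , Ax , m , m≤n⇒m≤1+n m≤k , w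
    reach⇒walk-out (suc k) (inj₂ (_ , p , _ , yz)) =
      let (x , Ax , m , m≤k , w) = reach⇒walk-out k p in x , Ax , suc m , s≤s m≤k , snoc w yz

    reach⇒walk-in : ∀ k {x} → Reach (flip Edge) W k A x →
                    ∃[ y ] y ∈ A × (∃[ m ] m ≤ k × Walk H m x y)
    reach⇒walk-in zero    (lift Ax) = _ , Ax , 0 , z≤n , stop
    reach⇒walk-in (suc k) (inj₁ p)  =
      let (y , Ay , m , m≤k , w) = reach⇒walk-in k p in y , Ay , m , m≤n⇒m≤1+n m≤k , w
    reach⇒walk-in (suc k) (inj₂ (_ , p , _ , xz)) =
      let (y , Ay , m , m≤k , w) = reach⇒walk-in k p in y , Ay , suc m , s≤s m≤k , step xz w

    reach⊆Out : ∀ k → Reach Edge W k A ⊆ Out H k A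
    reach⊆Out k p =
      let (x , Ax , _ , m≤k , w) = reach⇒walk-out k p
          (m , m≤ , q) = walk⇒path w
      in x , Ax , m , ≤-trans m≤ m≤k , q

    reach⊆In : ∀ k → Reach (flip Edge) W k A ⊆ In H k A
    reach⊆In k p =
      let (y , Ay , _ , m≤k , w) = reach⇒walk-in k p
          (m , m≤ , q) = walk⇒path w
      in y , Ay , m , ≤-trans m≤ m≤k , q

-- From kernels and splits to the classes of digraphs.

module _ (em : Classical) {v e} (G : Digraph v e) where
  open Digraph G

  kernel⇒𝔒𝔲𝔱 : ∀ {k W} → Universal W → Kernel Edge k W → 𝔒𝔲𝔱 k G
  kernel⇒𝔒𝔲𝔱 {k} all (kernel A _ indep covers) =
    A , indep , λ x → reach⊆Out em G k (covers (all x))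

  module _ {W : Pred Vertex (v ⊔ e)} where
    -- The membership proof in a refinement is irrelevant; it can be recovered because excluded
    -- middle decides `x ∈ W`.
    member : ((x , _) : Refinement Vertex W) → x ∈ W
    member (x , [ Wx ]) = recompute em Wx

    -- Each vertex that a walk passes comes with its proof of membership in `W`, so the walk lifts
    -- to the induced subgraph.
    reach-induced : ∀ (R : Rel Vertex e) k {A : Pred Vertex (v ⊔ e)} (x : Refinement Vertex W) →
                    Reach R W k A (value x) → Reach (R on value) (λ _ → ⊤ {0ℓ}) k (A ∘ value) x
    reach-induced R zero    x (lift Ax) = lift Ax
    reach-induced R (suc k) x (inj₁ p)  = inj₁ (reach-induced R k x p)
    reach-induced R (suc k) x (inj₂ (y , p , Wy , Ryx)) =
      inj₂ ((y , [ Wy ]) , reach-induced R k _ p , tt , Ryx)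

    kernel⇒induced-𝔒𝔲𝔱 : ∀ {k} → Kernel Edge k W → 𝔒𝔲𝔱 k (induced G W)
    kernel⇒induced-𝔒𝔲𝔱 {k} (kernel A _ indep covers) =
      A ∘ value ,
      (λ x y Ax Ay x≢y → indep _ _ Ax Ay (x≢y ∘ value-injective)) ,
      λ x → reach⊆Out em (induced G W) k (reach-induced Edge k x (covers (member x)))

    kernel⇒induced-ℑ𝔫 : ∀ {k} → Kernel (flip Edge) k W → ℑ𝔫 k (induced G W)
    kernel⇒induced-ℑ𝔫 {k} (kernel A _ indep covers) =
      A ∘ value ,
      (λ x y Ax Ay x≢y → indep _ _ Ay Ax (≢-sym x≢y ∘ value-injective)) ,
      λ x → reach⊆In em (induced G W) k (reach-induced (flip Edge) k x (covers (member x)))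

  split⇒ℑ𝔫-𝔒𝔲𝔱 : ∀ {i k W} → Universal W → Split Edge i k W → ℑ𝔫-𝔒𝔲𝔱 i k G
  split⇒ℑ𝔫-𝔒𝔲𝔱 all S =
    V₁ , V₂ , (λ x → exhaust (all x)) , disjoint ,
    kernel⇒induced-ℑ𝔫 sink , kernel⇒induced-𝔒𝔲𝔱 source
    where open Split S

  tuple⇒K⊂complement : ∀ {n} {W : Pred Vertex w} → IndependentTuple Edge n W → K n ⊂ᴳ complement G
  tuple⇒K⊂complement (f , _ , f-indep) = f , injective , f-indep
    where
    injective : ∀ {i j} → f i ≡ f j → i ≡ j
    injective {i} {j} fi≡fj =
      decidable-stable (i Fin.≟ j) (λ i≢j → proj₁ (f-indep i j i≢j) fi≡fj)

theorem3p2 : Classical → ∀ {v e} (G : Digraph v e) (n : ℕ) → 2 ≤ n →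
    ¬ (K n ⊂ᴳ complement G) →
    ℑ𝔫-𝔒𝔲𝔱 2 2 G ×
    (n ≡ 2 → 𝔒𝔲𝔱 2 G ⊎ ℑ𝔫-𝔒𝔲𝔱 1 1 G) ×
    (n ≡ 3 → ℑ𝔫-𝔒𝔲𝔱 1 2 G ⊎ ℑ𝔫-𝔒𝔲𝔱 2 1 G)
theorem3p2 em G n _ ¬K =
  -- All three parts take `W` to be the whole vertex set.
  split⇒ℑ𝔫-𝔒𝔲𝔱 em G all (split₂₂ em Edge n (λ _ → ⊤) ¬t) ,
  (λ { refl → ⊎-map (kernel⇒𝔒𝔲𝔱 em G all) (split⇒ℑ𝔫-𝔒𝔲𝔱 em G all)
                    (kernel₂⊎split₁₁ em Edge (λ _ → ⊤) ¬t) }) ,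
  (λ { refl → ⊎-map (split⇒ℑ𝔫-𝔒𝔲𝔱 em G all) (split⇒ℑ𝔫-𝔒𝔲𝔱 em G all)
                    (split₁₂⊎split₂₁ em Edge (λ _ → ⊤) ¬t) })
  where
  open Digraph G
  all : ∀ {ℓ} → Universal (λ (_ : Vertex) → ⊤ {ℓ})
  all _ = tt

  ¬t : ∀ {ℓ} → ¬ IndependentTuple Edge n (λ _ → ⊤ {ℓ})
  ¬t = ¬K ∘ tuple⇒K⊂complement em G
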